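{- Let $\frac{a}{b} < \frac{c}{d}$ be non-negative fractions in lowest terms (with $b,d>0$) whose cross-determinant $bc-ad$ is a power of two, i.e. $bc - ad = 2^k$ for some integer $k \ge 0$. Then every rational number in the interval $\left[\frac{a}{b}, \frac{c}{d}\right]$ appears in the tree $T\left(\frac{a}{b}, \frac{c}{d}\right)$. Furthermore, there exists $L$ such that for all $i \ge L$ each pair of consecutive elements in $S_i\left(\frac{a}{b}, \frac{c}{d}\right)$ has cross-determinant $1$.
   Context: All fractions are written in lowest terms with positive denominator. The cross-determinant of two consecutive reduced fractions $\frac{p}{q}, \frac{r}{s}$ (in this order) is $qr - ps$. The mediant of two reduced fractions $\frac{p}{q}$ and $\frac{r}{s}$ is the fraction $\frac{p+r}{q+s}$ put in lowest terms. Given two non-negative rational numbers $\frac{a}{b} < \frac{c}{d}$ in lowest terms, define finite sequences (rows) $S_n\left(\frac{a}{b},\frac{c}{d}\right)$, $n \ge 0$, of reduced fractions: $S_0 = \left(\frac{a}{b}, \frac{c}{d}\right)$, and $S_{n+1}$ is obtained from $S_n$ by copying all terms and inserting between every two consecutive terms their (reduced) mediant, where the mediant is computed from the reduced forms of the two terms. The tree $T\left(\frac{a}{b},\frac{c}{d}\right)$ is the collection of all the rows $S_n\left(\frac{a}{b},\frac{c}{d}\right)$, $n\ge 0$; a rational number appears in the tree if it is a term of some row. -}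

module Defs where

open import Data.Integer.Base as ℤ using (ℤ)
open import Data.List.Base using (List; []; _∷_)
open import Data.List.Membership.Propositional using (_∈_)
open import Data.Nat.Base as ℕ using (ℕ; zero; suc)
open import Data.Product.Base using (∃-syntax)
open import Data.Rational.Base using (ℚ; ↥_; ↧_; ↧ₙ_; _/_)

-- Elements of ℚ are stored in lowest terms with positive denominator, so
-- numerators and denominators below are those of the reduced fractions.

crossDet : ℚ → ℚ → ℤ
crossDet x y = ↧ x ℤ.* ↥ y ℤ.- ↥ x ℤ.* ↧ y

-- _/_ reduces its result to lowest terms.
mediant : ℚ → ℚ → ℚ
mediant x y = (↥ x ℤ.+ ↥ y) / (↧ₙ x ℕ.+ ↧ₙ y)

insertMediants : List ℚ → List ℚ
insertMediants []           = []
insertMediants (x ∷ [])     = x ∷ []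
insertMediants (x ∷ y ∷ zs) = x ∷ mediant x y ∷ insertMediants (y ∷ zs)

S : ℕ → ℚ → ℚ → List ℚ
S zero    p q = p ∷ q ∷ []
S (suc n) p q = insertMediants (S n p q)

infix 4 _∈T[_,_]

_∈T[_,_] : ℚ → ℚ → ℚ → Set
x ∈T[ p , q ] = ∃[ n ] x ∈ S n p q

{-# OPTIONS --safe #-}

-- Write g for the gcd cancelled in the mediant m of r and s.  The cross-determinant is bilinear
-- in the vectors (numerator, denominator), so g · crossDet m z = crossDet r z + crossDet s z.
--
-- Consequently both pairs (r , m) and (m , s) have cross-determinant crossDet r s / g.  If
-- crossDet r s is even, then r and s agree modulo 2 (both are nonzero vectors over 𝔽₂), so g is
-- even; hence, starting from 2 ^ k, every cross-determinant is 1 from row k on.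
--
-- If r ≤ x ≤ s with u = crossDet r x and v = crossDet x s, then passing to the half containing x
-- replaces (u , v) by ((u − v) / g , v) or (u , (v − u) / g): a Euclidean algorithm, which ends
-- with u = 0 or v = 0, i.e. with x an endpoint.

module Submission where

open import Defs
open import Data.Empty using (⊥; ⊥-elim-irr)
open import Data.Integer.Base as ℤ using (ℤ; +_; -[1+_]; 0ℤ; 1ℤ)
open import Data.Integer.DivMod using (_/_; _%_; a≡a%n+[a/n]*n; n%d<d)
open import Data.Integer.Divisibility.Signed
  using (_∣_; divides; _∣?_; ∣⇒∣ᵤ; ∣ᵤ⇒∣; ∣m∣n⇒∣m+n; ∣m+n∣m⇒∣n; ∣m⇒∣-m; ∣m⇒∣m*n; ∣n⇒∣m*n)
import Data.Integer.GCD as ℤ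
import Data.Integer.Properties as ℤ
open import Data.Integer.Tactic.RingSolver using (solve-∀)
open import Data.List.Base using (List; []; _∷_)
open import Data.List.Membership.Propositional using (_∈_)
open import Data.List.Relation.Unary.Any using (here; there)
open import Data.List.Relation.Unary.Linked as Linked using (Linked; []; [-]; _∷_)
open import Data.Nat.Base as ℕ using (ℕ; zero; suc; _^_; _∸_; NonZero; s≤s)
open import Data.Nat.Coprimality using (coprime-divisor; Coprime)
import Data.Nat.Divisibility as ℕ
import Data.Nat.GCD as ℕ
open import Data.Nat.Primality using (prime[2]; prime⇒irreducible; euclidsLemma)
import Data.Nat.Properties as ℕ
open import Data.Product.Base using (_×_; _,_; proj₁; proj₂; ∃-syntax)
open import Data.Rational.Base using (ℚ; mkℚ; 0ℚ; _≤_; _<_; ↥_; ↧_; ↧ₙ_; *≡*)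
open import Data.Rational.Properties using (↥-/; ↧-/; ≃⇒≡; drop-*≤*)
open import Data.Sum.Base as Sum using (_⊎_; inj₁; inj₂)
open import Relation.Binary.Core using (Rel)
open import Relation.Binary.PropositionalEquality
  using (_≡_; refl; sym; trans; cong; cong₂; subst; module ≡-Reasoning)
open import Relation.Nullary using (¬_; yes; no; contradiction)

-- Linearity of the cross-determinant

mediantGcd : ℚ → ℚ → ℕ
mediantGcd x y = ℕ.gcd ℤ.∣ ↥ x ℤ.+ ↥ y ∣ (↧ₙ x ℕ.+ ↧ₙ y)

mediantGcd-nonZero : ∀ x y → NonZero (mediantGcd x y)
mediantGcd-nonZero x y =
  ℕ.≢-nonZero (ℕ.gcd[m,n]≢0 ℤ.∣ ↥ x ℤ.+ ↥ y ∣ (↧ₙ x ℕ.+ ↧ₙ y) (inj₂ λ ()))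

↥-mediant : ∀ x y → ↥ (mediant x y) ℤ.* + mediantGcd x y ≡ ↥ x ℤ.+ ↥ y
↥-mediant x y = ↥-/ (↥ x ℤ.+ ↥ y) (↧ₙ x ℕ.+ ↧ₙ y)

↧-mediant : ∀ x y → ↧ (mediant x y) ℤ.* + mediantGcd x y ≡ ↧ x ℤ.+ ↧ y
↧-mediant x y = ↧-/ (↥ x ℤ.+ ↥ y) (↧ₙ x ℕ.+ ↧ₙ y)

crossDet-self : ∀ x → crossDet x x ≡ 0ℤ
crossDet-self x = commutes (↥ x) (↧ x)
  where
  commutes : ∀ a b → b ℤ.* a ℤ.- a ℤ.* b ≡ 0ℤ
  commutes = solve-∀

crossDet-antisym : ∀ x y → crossDet y x ≡ ℤ.- crossDet x y
crossDet-antisym x y = swap (↥ x) (↧ x) (↥ y) (↧ y)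
  where
  swap : ∀ a b c d → d ℤ.* a ℤ.- c ℤ.* b ≡ ℤ.- (b ℤ.* c ℤ.- a ℤ.* d)
  swap = solve-∀

crossDet-mediantˡ : ∀ x y z →
  crossDet (mediant x y) z ℤ.* + mediantGcd x y ≡ crossDet x z ℤ.+ crossDet y z
crossDet-mediantˡ x y z = begin
  crossDet m z ℤ.* g
    ≡⟨ distribute (↥ m) (↧ m) g (↥ z) (↧ z) ⟩
  (↧ m ℤ.* g) ℤ.* ↥ z ℤ.- (↥ m ℤ.* g) ℤ.* ↧ z
    ≡⟨ cong₂ (λ b a → b ℤ.* ↥ z ℤ.- a ℤ.* ↧ z) (↧-mediant x y) (↥-mediant x y) ⟩
  (↧ x ℤ.+ ↧ y) ℤ.* ↥ z ℤ.- (↥ x ℤ.+ ↥ y) ℤ.* ↧ z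
    ≡⟨ collect (↥ x) (↧ x) (↥ y) (↧ y) (↥ z) (↧ z) ⟩
  crossDet x z ℤ.+ crossDet y z ∎
  where
  open ≡-Reasoning
  m = mediant x y
  g = + mediantGcd x y
  distribute : ∀ a b g e f →
    (b ℤ.* e ℤ.- a ℤ.* f) ℤ.* g ≡ (b ℤ.* g) ℤ.* e ℤ.- (a ℤ.* g) ℤ.* f
  distribute = solve-∀
  collect : ∀ a b c d e f →
    (b ℤ.+ d) ℤ.* e ℤ.- (a ℤ.+ c) ℤ.* f ≡ (b ℤ.* e ℤ.- a ℤ.* f) ℤ.+ (d ℤ.* e ℤ.- c ℤ.* f)
  collect = solve-∀

crossDet-mediantʳ : ∀ x y z →
  crossDet z (mediant x y) ℤ.* + mediantGcd x y ≡ crossDet z x ℤ.+ crossDet z y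
crossDet-mediantʳ x y z = begin
  crossDet z m ℤ.* g                         ≡⟨ cong (ℤ._* g) (crossDet-antisym m z) ⟩
  (ℤ.- crossDet m z) ℤ.* g                   ≡⟨ ℤ.neg-distribˡ-* (crossDet m z) g ⟨
  ℤ.- (crossDet m z ℤ.* g)                   ≡⟨ cong ℤ.-_ (crossDet-mediantˡ x y z) ⟩
  ℤ.- (crossDet x z ℤ.+ crossDet y z)        ≡⟨ ℤ.neg-distrib-+ (crossDet x z) (crossDet y z) ⟩
  ℤ.- crossDet x z ℤ.+ ℤ.- crossDet y z      ≡⟨ cong₂ ℤ._+_ (crossDet-antisym x z) (crossDet-antisym y z) ⟨
  crossDet z x ℤ.+ crossDet z y              ∎
  where
  open ≡-Reasoning
  m = mediant x y
  g = + mediantGcd x y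

crossDet-leftChild : ∀ x y → crossDet x (mediant x y) ℤ.* + mediantGcd x y ≡ crossDet x y
crossDet-leftChild x y = begin
  crossDet x (mediant x y) ℤ.* + mediantGcd x y ≡⟨ crossDet-mediantʳ x y x ⟩
  crossDet x x ℤ.+ crossDet x y                 ≡⟨ cong (ℤ._+ crossDet x y) (crossDet-self x) ⟩
  0ℤ ℤ.+ crossDet x y                           ≡⟨ ℤ.+-identityˡ _ ⟩
  crossDet x y                                  ∎
  where open ≡-Reasoning

crossDet-rightChild : ∀ x y → crossDet (mediant x y) y ℤ.* + mediantGcd x y ≡ crossDet x y
crossDet-rightChild x y = begin
  crossDet (mediant x y) y ℤ.* + mediantGcd x y ≡⟨ crossDet-mediantˡ x y y ⟩
  crossDet x y ℤ.+ crossDet y y                 ≡⟨ cong (λ i → crossDet x y ℤ.+ i) (crossDet-self y) ⟩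
  crossDet x y ℤ.+ 0ℤ                           ≡⟨ ℤ.+-identityʳ _ ⟩
  crossDet x y                                  ∎
  where open ≡-Reasoning

-- Ends the descent: equal values have a single reduced form, so `x` coincides with an endpoint.
crossDet≡0⇒≡ : ∀ x y → crossDet x y ≡ 0ℤ → x ≡ y
crossDet≡0⇒≡ x y eq = ≃⇒≡ (*≡* (begin
  ↥ x ℤ.* ↧ y  ≡⟨ ℤ.i-j≡0⇒i≡j (↧ x ℤ.* ↥ y) (↥ x ℤ.* ↧ y) eq ⟨
  ↧ x ℤ.* ↥ y  ≡⟨ ℤ.*-comm (↧ x) (↥ y) ⟩
  ↥ y ℤ.* ↧ x  ∎))
  where open ≡-Reasoning

≤⇒crossDet≡+ : ∀ {x y} → x ≤ y → ∃[ u ] crossDet x y ≡ + u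
≤⇒crossDet≡+ {x} {y} x≤y = ℤ.∣ crossDet x y ∣ , sym (ℤ.0≤i⇒+∣i∣≡i 0≤det)
  where
  0≤det : 0ℤ ℤ.≤ crossDet x y
  0≤det = subst (λ i → 0ℤ ℤ.≤ i ℤ.- ↥ x ℤ.* ↧ y) (ℤ.*-comm (↥ y) (↧ x))
    (ℤ.i≤j⇒0≤j-i (drop-*≤* x≤y))

-- Cancelling the positive gcd keeps the determinants nonnegative, so the rest of the argument can
-- run in ℕ.
quotient-+ : ∀ i g {n} .{{_ : NonZero g}} → i ℤ.* + g ≡ + n → ∃[ w ] (i ≡ + w × w ℕ.* g ≡ n)
quotient-+ (+ w)    g       eq = w , refl , ℤ.+-injective (trans (ℤ.pos-* w g) eq)
quotient-+ -[1+ w ] (suc g) ()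

quotient-+-≤ : ∀ i g {n} .{{_ : NonZero g}} → i ℤ.* + g ≡ + n → ∃[ w ] (i ≡ + w × w ℕ.≤ n)
quotient-+-≤ i g eq with w , i≡w , refl ← quotient-+ i g eq = w , i≡w , ℕ.m≤m*n w g

-- Parity of the mediant

Even : ℤ → Set
Even i = + 2 ∣ i

odd⇒1+2* : ∀ {i} → ¬ Even i → ∃[ q ] i ≡ 1ℤ ℤ.+ q ℤ.* + 2
odd⇒1+2* {i} odd with i % + 2 | a≡a%n+[a/n]*n i (+ 2) | n%d<d i (+ 2)
... | zero          | eq | _ = contradiction (divides (i / + 2) (trans eq (ℤ.+-identityˡ _))) odd
... | suc zero      | eq | _ = i / + 2 , eq
... | suc (suc _)   | _  | s≤s (s≤s ())

odd+odd⇒even : ∀ {i j} → ¬ Even i → ¬ Even j → Even (i ℤ.+ j)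
odd+odd⇒even oi oj with q , refl ← odd⇒1+2* oi | r , refl ← odd⇒1+2* oj =
  divides (1ℤ ℤ.+ q ℤ.+ r) (halve q r)
  where
  halve : ∀ q r → (1ℤ ℤ.+ q ℤ.* + 2) ℤ.+ (1ℤ ℤ.+ r ℤ.* + 2) ≡ (1ℤ ℤ.+ q ℤ.+ r) ℤ.* + 2
  halve = solve-∀

even-*⇒even : ∀ i j → Even (i ℤ.* j) → Even i ⊎ Even j
even-*⇒even i j e = Sum.map ∣ᵤ⇒∣ ∣ᵤ⇒∣
  (euclidsLemma ℤ.∣ i ∣ ℤ.∣ j ∣ prime[2] (subst (2 ℕ.∣_) (ℤ.abs-* i j) (∣⇒∣ᵤ e)))

¬even-↥↧ : ∀ x → Even (↥ x) → ¬ Even (↧ x)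
-- The coprimality field of `mkℚ` is irrelevant, so it may only be used to derive an irrelevant ⊥.
¬even-↥↧ (mkℚ n d coprime) e f = ⊥-elim-irr (absurd coprime)
  where
  absurd : Coprime ℤ.∣ n ∣ (suc d) → ⊥
  absurd c with () ← c (∣⇒∣ᵤ e , ∣⇒∣ᵤ f)

-- Two nonzero vectors over 𝔽₂ with determinant 0 are equal, so their sum is 0. The cases are the
-- parities of the denominators; in the mixed ones the fraction with even denominator would also
-- have an even numerator.
even-↥+↥×↧+↧ : ∀ x y → Even (crossDet x y) → Even (↥ x ℤ.+ ↥ y) × Even (↧ x ℤ.+ ↧ y)
even-↥+↥×↧+↧ x y e with + 2 ∣? ↧ x | + 2 ∣? ↧ y
... | yes ex | yes ey =
  odd+odd⇒even (λ f → ¬even-↥↧ x f ex) (λ f → ¬even-↥↧ y f ey) , ∣m∣n⇒∣m+n ex ey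
... | yes ex | no oy with even-*⇒even (↥ x) (↧ y) even-ad
  where
  even-ad : Even (↥ x ℤ.* ↧ y)
  even-ad = subst Even (ℤ.neg-involutive _)
    (∣m⇒∣-m (∣m+n∣m⇒∣n e (∣m⇒∣m*n (↥ y) ex)))
...   | inj₁ f = contradiction ex (¬even-↥↧ x f)
...   | inj₂ f = contradiction f oy
even-↥+↥×↧+↧ x y e | no ox | yes ey with even-*⇒even (↧ x) (↥ y) even-bc
  where
  restore : ∀ i j → (i ℤ.- j) ℤ.+ j ≡ i
  restore = solve-∀
  even-bc : Even (↧ x ℤ.* ↥ y)
  even-bc = subst Even (restore _ _) (∣m∣n⇒∣m+n e (∣n⇒∣m*n (↥ x) ey))
...   | inj₁ f = contradiction f ox
...   | inj₂ f = contradiction ey (¬even-↥↧ y f)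
-- With x = a/b and y = c/d: b(a + c) = (bc - ad) + a(b + d) is even, and b is odd.
even-↥+↥×↧+↧ x y e | no ox | no oy with even-*⇒even (↧ x) (↥ x ℤ.+ ↥ y) even-b[a+c]
  where
  expand : ∀ a b c d → (b ℤ.* c ℤ.- a ℤ.* d) ℤ.+ a ℤ.* (b ℤ.+ d) ≡ b ℤ.* (a ℤ.+ c)
  expand = solve-∀
  even-b[a+c] : Even (↧ x ℤ.* (↥ x ℤ.+ ↥ y))
  even-b[a+c] = subst Even (expand (↥ x) (↧ x) (↥ y) (↧ y))
    (∣m∣n⇒∣m+n e (∣n⇒∣m*n (↥ x) (odd+odd⇒even ox oy)))
...   | inj₁ f = contradiction f ox
...   | inj₂ f = f , odd+odd⇒even ox oy

even⇒2∣mediantGcd : ∀ x y → Even (crossDet x y) → 2 ℕ.∣ mediantGcd x y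
even⇒2∣mediantGcd x y e with e↥ , e↧ ← even-↥+↥×↧+↧ x y e =
  ℕ.gcd-greatest (∣⇒∣ᵤ e↥) (∣⇒∣ᵤ e↧)

odd⇒coprime-2 : ∀ {d} → ¬ 2 ℕ.∣ d → Coprime d 2
odd⇒coprime-2 odd (i∣d , i∣2) with prime⇒irreducible prime[2] i∣2
... | inj₁ i≡1  = i≡1
... | inj₂ refl = contradiction i∣d odd

-- Divisibility, not equality, because one gcd may absorb several factors 2 and different pairs of a
-- row may lose different numbers of them.
CrossDetDivides2^ : ℕ → ℚ → ℚ → Set
CrossDetDivides2^ j x y = ∃[ d ] (crossDet x y ≡ + d × d ℕ.∣ 2 ^ j)

-- An odd `d` is coprime to 2 and already divides the smaller power. For even `d`, 2w divides wg =
-- d, and a factor 2 cancels.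
quotient-∣2^pred : ∀ j {d} w g → (2 ℕ.∣ d → 2 ℕ.∣ g) → w ℕ.* g ≡ d → d ℕ.∣ 2 ^ j →
  w ℕ.∣ 2 ^ ℕ.pred j
quotient-∣2^pred zero        w g _    refl d∣ = ℕ.∣-trans (ℕ.m∣m*n g) d∣
quotient-∣2^pred (suc j) {d} w g even refl d∣ with 2 ℕ.∣? d
... | no odd  = ℕ.∣-trans (ℕ.m∣m*n g) (coprime-divisor (odd⇒coprime-2 odd) d∣)
... | yes 2∣d = ℕ.*-cancelˡ-∣ 2
  (ℕ.∣-trans (subst (ℕ._∣ d) (ℕ.*-comm w 2) (ℕ.*-monoʳ-∣ w (even 2∣d))) d∣)

-- Stated for any `i` satisfying the equation that both children share, so that it serves the left
-- and the right one.
crossDetDivides-child : ∀ j x y i → i ℤ.* + mediantGcd x y ≡ crossDet x y →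
  CrossDetDivides2^ j x y → ∃[ w ] (i ≡ + w × w ℕ.∣ 2 ^ ℕ.pred j)
crossDetDivides-child j x y i eq (d , det≡d , d∣)
  with w , i≡w , wg≡d ← quotient-+ i (mediantGcd x y) {{mediantGcd-nonZero x y}} (trans eq det≡d) =
  w , i≡w , quotient-∣2^pred j w (mediantGcd x y) even wg≡d d∣
  where
  even : 2 ℕ.∣ d → 2 ℕ.∣ mediantGcd x y
  even 2∣d = even⇒2∣mediantGcd x y (subst Even (sym det≡d) (∣ᵤ⇒∣ 2∣d))

-- Rows of the tree

insertMediants⁺ : ∀ {a b} {P : Rel ℚ a} {Q : Rel ℚ b} →
  (∀ x y → P x y → Q x (mediant x y) × Q (mediant x y) y) →
  ∀ {xs} → Linked P xs → Linked Q (insertMediants xs)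
insertMediants⁺ step []                 = []
insertMediants⁺ step [-]                = [-]
insertMediants⁺ step (p ∷ [-])          = proj₁ (step _ _ p) ∷ proj₂ (step _ _ p) ∷ [-]
-- Matching on `ps` exposes the head of the remaining row, which lets `insertMediants` unfold.
insertMediants⁺ step (p ∷ ps@(_ ∷ _))   =
  proj₁ (step _ _ p) ∷ proj₂ (step _ _ p) ∷ insertMediants⁺ step ps

-- Each row lowers the exponent by one; truncated subtraction keeps it at 0 from row `k` on, just as
-- `ℕ.pred` does.
crossDetDivides-S : ∀ k p q → crossDet p q ≡ + (2 ^ k) →
  ∀ n → Linked (CrossDetDivides2^ (k ∸ n)) (S n p q)
crossDetDivides-S k p q eq zero    = (2 ^ k , eq , ℕ.∣-refl) ∷ [-]
crossDetDivides-S k p q eq (suc n) =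
  subst (λ j → Linked (CrossDetDivides2^ j) (S (suc n) p q)) (ℕ.pred[m∸n]≡m∸[1+n] k n)
    (insertMediants⁺ children (crossDetDivides-S k p q eq n))
  where
  children : ∀ x y → CrossDetDivides2^ (k ∸ n) x y →
    CrossDetDivides2^ (ℕ.pred (k ∸ n)) x (mediant x y) ×
    CrossDetDivides2^ (ℕ.pred (k ∸ n)) (mediant x y) y
  children x y D =
    crossDetDivides-child (k ∸ n) x y _ (crossDet-leftChild x y) D ,
    crossDetDivides-child (k ∸ n) x y _ (crossDet-rightChild x y) D

-- The descent follows one adjacent pair from row to row, so adjacency is needed as a witness for a
-- particular pair.
data Consecutive (x y : ℚ) : List ℚ → Set where
  here  : ∀ {zs} → Consecutive x y (x ∷ y ∷ zs)
  there : ∀ {z zs} → Consecutive x y zs → Consecutive x y (z ∷ zs)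

consecutive⇒∈ˡ : ∀ {x y zs} → Consecutive x y zs → x ∈ zs
consecutive⇒∈ˡ here      = here refl
consecutive⇒∈ˡ (there c) = there (consecutive⇒∈ˡ c)

consecutive⇒∈ʳ : ∀ {x y zs} → Consecutive x y zs → y ∈ zs
consecutive⇒∈ʳ here      = there (here refl)
consecutive⇒∈ʳ (there c) = there (consecutive⇒∈ʳ c)

consecutive-leftChild : ∀ {x y zs} → Consecutive x y zs →
  Consecutive x (mediant x y) (insertMediants zs)
consecutive-leftChild here                = here
-- Splitting `c` shows that the tail is nonempty, so `insertMediants` unfolds.
consecutive-leftChild (there c@here)      = there (there (consecutive-leftChild c))
consecutive-leftChild (there c@(there _)) = there (there (consecutive-leftChild c))

consecutive-rightChild : ∀ {x y zs} → Consecutive x y zs →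
  Consecutive (mediant x y) y (insertMediants zs)
consecutive-rightChild (here {[]})         = there here
consecutive-rightChild (here {_ ∷ _})      = there here
consecutive-rightChild (there c@here)      = there (there (consecutive-rightChild c))
consecutive-rightChild (there c@(there _)) = there (there (consecutive-rightChild c))

-- Euclidean descent

difference : ∀ {i j u v} → i ≡ + u → j ≡ + v → v ℕ.≤ u → i ℤ.- j ≡ + (u ∸ v)
difference {u = u} {v} refl refl v≤u = trans (ℤ.m-n≡m⊖n u v) (ℤ.⊖-≥ v≤u)

-- Natural `u` and `v` encode that `x` lies between `r` and `s`. The recursion is on `bound`, since
-- the division by the gcd makes `u` and `v` shrink in a non-structural way.
descend : ∀ {p q x} bound n r s {u v} → Consecutive r s (S n p q) →
  crossDet r x ≡ + u → crossDet x s ≡ + v → u ℕ.+ v ℕ.< bound → x ∈T[ p , q ]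
descend _ n r s {zero} c rx xs _ = n , subst (_∈ S n _ _) (crossDet≡0⇒≡ r _ rx) (consecutive⇒∈ˡ c)
descend _ n r s {suc _} {zero} c rx xs _ =
  n , subst (_∈ S n _ _) (sym (crossDet≡0⇒≡ _ s xs)) (consecutive⇒∈ʳ c)
descend {x = x} (suc bound) n r s {u@(suc _)} {v@(suc _)} c rx xs (s≤s u+v≤bound)
  -- The determinant of the mediant and `x`, times the gcd, is u - v; its sign tells which half
  -- contains `x`. The new sum is at most the larger of `u` and `v`, which is below u + v as both
  -- are positive.
  with ℕ.≤-total v u
... | inj₁ v≤u =
  let w , mx , w≤u∸v = quotient-+-≤ (crossDet (mediant r s) x) (mediantGcd r s) {{mediantGcd-nonZero r s}} mx*g
  in descend bound (suc n) (mediant r s) s (consecutive-rightChild c) mx xs (begin-strict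
       w ℕ.+ v        ≤⟨ ℕ.+-monoˡ-≤ v w≤u∸v ⟩
       u ∸ v ℕ.+ v    ≡⟨ ℕ.m∸n+n≡m v≤u ⟩
       u              <⟨ ℕ.m<m+n u ℕ.z<s ⟩
       u ℕ.+ v        ≤⟨ u+v≤bound ⟩
       bound          ∎)
  where
  open ℕ.≤-Reasoning
  mx*g : crossDet (mediant r s) x ℤ.* + mediantGcd r s ≡ + (u ∸ v)
  mx*g = trans (crossDet-mediantˡ r s x)
    (trans (cong (λ i → crossDet r x ℤ.+ i) (crossDet-antisym x s)) (difference rx xs v≤u))
... | inj₂ u≤v =
  let w , xm , w≤v∸u = quotient-+-≤ (crossDet x (mediant r s)) (mediantGcd r s) {{mediantGcd-nonZero r s}} xm*g
  in descend bound (suc n) r (mediant r s) (consecutive-leftChild c) rx xm (begin-strict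
       u ℕ.+ w        ≤⟨ ℕ.+-monoʳ-≤ u w≤v∸u ⟩
       u ℕ.+ (v ∸ u)  ≡⟨ ℕ.m+[n∸m]≡n u≤v ⟩
       v              <⟨ ℕ.m<n+m v ℕ.z<s ⟩
       u ℕ.+ v        ≤⟨ u+v≤bound ⟩
       bound          ∎)
  where
  open ℕ.≤-Reasoning
  xm*g : crossDet x (mediant r s) ℤ.* + mediantGcd r s ≡ + (v ∸ u)
  xm*g = trans (crossDet-mediantʳ r s x) (trans (ℤ.+-comm (crossDet x r) (crossDet x s))
    (trans (cong (λ i → crossDet x s ℤ.+ i) (crossDet-antisym r x)) (difference xs rx u≤v)))

∈T : ∀ {p q x} → p ≤ x → x ≤ q → x ∈T[ p , q ]
∈T p≤x x≤q with _ , px ← ≤⇒crossDet≡+ p≤x | _ , xq ← ≤⇒crossDet≡+ x≤q =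
  descend _ 0 _ _ here px xq (ℕ.n<1+n _)

theorem3p2 : ∀ (p q : ℚ) → 0ℚ ≤ p → 0ℚ ≤ q → p < q →
    ∀ (k : ℕ) → crossDet p q ≡ + (2 ^ k) →
    (∀ (x : ℚ) → p ≤ x → x ≤ q → x ∈T[ p , q ]) ×
    (∃[ L ] (∀ (i : ℕ) → L ℕ.≤ i → Linked (λ r s → crossDet r s ≡ + 1) (S i p q)))
-- L is `k`: from that row on every determinant divides 2 ^ 0.
theorem3p2 p q _ _ _ k det≡2^k = (λ x → ∈T) , k , eventually-1
  where
  eventually-1 : ∀ i → k ℕ.≤ i → Linked (λ r s → crossDet r s ≡ + 1) (S i p q)
  eventually-1 i k≤i = Linked.map (λ {r s} → unit r s)
    (subst (λ j → Linked (CrossDetDivides2^ j) (S i p q)) (ℕ.m≤n⇒m∸n≡0 k≤i)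
      (crossDetDivides-S k p q det≡2^k i))
    where
    unit : ∀ r s → CrossDetDivides2^ 0 r s → crossDet r s ≡ + 1
    unit _ _ (_ , det≡d , d∣1) = trans det≡d (cong +_ (ℕ.∣1⇒≡1 d∣1))
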